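{- Let $G$ be a finite abelian group with identity $0$, and let $M$ and $N$ be matroids over $G$, both of rank $n$, such that $|E(M)|=|E(N)|=n+1<p(G)$. Assume that $|(-a+E(M))\cap E(N)|\neq n$ for all $a\in E(M)$, and that $E(M)$ is neither a progression nor a semi-progression. If $0\notin E(N)$, then $M$ is matched to $N$.
   Context: $p(G)$ denotes the smallest cardinality of a nonzero subgroup of $G$. For $a\in G$ and $X\subseteq G$, $-a+X=\{ -a+x: x\in X\}$. A progression of length $k$ with difference $x$ and initial term $a$ is a set $\{a,a+x,\dots,a+(k-1)x\}$; a set $A$ is a semi-progression if $A\setminus\{a\}$ is a progression for some $a\in A$. A matroid over $G$ is a matroid $M$ whose finite ground set $E(M)$ is a subset of $G$; all matroids are assumed loopless. For matroids $M,N$ over $G$ with $r(M)=r(N)=n>0$ and bases $\mathcal{M}=\{a_1,\dots,a_n\}$ of $M$ and $\mathcal{N}=\{b_1,\dots,b_n\}$ of $N$, $\mathcal{M}$ is matched to $\mathcal{N}$ if there is a permutation $\pi\in S_n$ with $a_i+b_{\pi(i)}\notin E(M)$ for all $i$. $M$ is matched to $N$ if for every basis $\mathcal{M}$ of $M$ there exists a basis $\mathcal{N}$ of $N$ such that $\mathcal{M}$ is matched to $\mathcal{N}$. -}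

module Defs where

open import Algebra.Bundles using (AbelianGroup)
import Algebra.Definitions.RawMonoid as RawMonoidDefinitions
open import Data.Fin.Base using (Fin; toℕ)
open import Data.Fin.Permutation using (Permutation′; _⟨$⟩ʳ_)
open import Data.Fin.Properties using (any?; _≟_)
open import Data.Fin.Subset using (Subset; _∈_; _∉_; _⊆_; _∪_; _-_; ⁅_⁆; ⊥; ∣_∣)
open import Data.Fin.Subset.Properties using (_∈?_)
open import Data.Nat.Base using (ℕ; suc; _≤_; _<_)
open import Data.Product.Base using (Σ-syntax; ∃-syntax; _×_)
open import Data.Vec.Base using (tabulate)
open import Function.Bundles using (Inverse; _⇔_)
open import Function.Definitions using (Injective)
open import Level using (Level; 0ℓ; _⊔_) renaming (suc to lsuc)
open import Relation.Binary.PropositionalEquality using (_≡_; setoid)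
open import Relation.Nullary using (¬_)
open import Relation.Nullary.Decidable using (⌊_⌋; _×-dec_)
open import Relation.Unary using (Pred; Decidable)

record FiniteAbelianGroup (c ℓ : Level) : Set (lsuc (c ⊔ ℓ)) where
  field
    abelianGroup : AbelianGroup c ℓ
    order        : ℕ
    enumeration  : Inverse (AbelianGroup.setoid abelianGroup) (setoid (Fin order))

  open AbelianGroup abelianGroup public
    using (Carrier; _≈_; rawMonoid)
    renaming (_∙_ to infixl 6 _+_; ε to 0#; _⁻¹ to infix 8 -_)

  open RawMonoidDefinitions rawMonoid public
    using () renaming (_×_ to infixr 8 _·_)

  index : Carrier → Fin order
  index = Inverse.to enumeration

  element : Fin order → Carrier
  element = Inverse.from enumeration

-- Subsets of G are represented by sets of indices; `x ∈ᴳ S` is membership of a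
-- group element.
module Over {c ℓ : Level} (G : FiniteAbelianGroup c ℓ) where

  open FiniteAbelianGroup G

  SubsetOfG : Set
  SubsetOfG = Subset order

  infix 4 _∈ᴳ_ _∉ᴳ_

  _∈ᴳ_ : Carrier → SubsetOfG → Set
  x ∈ᴳ S = index x ∈ S

  _∉ᴳ_ : Carrier → SubsetOfG → Set
  x ∉ᴳ S = index x ∉ S

  -- g ⊕ X = { g + x : x ∈ X }
  infixr 7 _⊕_
  _⊕_ : Carrier → SubsetOfG → SubsetOfG
  g ⊕ X = tabulate λ i → ⌊ any? (λ j → (j ∈? X) ×-dec (i ≟ index (g + element j))) ⌋

  record IsSubgroup (H : SubsetOfG) : Set c where
    field
      0∈       : 0# ∈ᴳ H
      +-closed : ∀ {x y} → x ∈ᴳ H → y ∈ᴳ H → (x + y) ∈ᴳ H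
      -‿closed : ∀ {x} → x ∈ᴳ H → (- x) ∈ᴳ H

  IsNonzeroSubgroup : SubsetOfG → Set (c ⊔ ℓ)
  IsNonzeroSubgroup H = IsSubgroup H × (∃[ x ] (x ∈ᴳ H × ¬ (x ≈ 0#)))

  -- `Is-p q` says q = p(G). No q satisfies it when G is trivial.
  Is-p : ℕ → Set (c ⊔ ℓ)
  Is-p q = (∃[ H ] (IsNonzeroSubgroup H × ∣ H ∣ ≡ q))
         × (∀ H → IsNonzeroSubgroup H → q ≤ ∣ H ∣)

  -- The length is suc k, since a progression has an initial term. The terms need
  -- not be distinct, but dropping repetitions yields the same set with distinct
  -- terms.
  IsProgression : SubsetOfG → Set (c ⊔ ℓ)
  IsProgression A = ∃[ k ] ∃[ a ] ∃[ d ]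
    (∀ x → x ∈ᴳ A ⇔ (Σ[ i ∈ Fin (suc k) ] x ≈ a + toℕ i · d))

  IsSemiProgression : SubsetOfG → Set (c ⊔ ℓ)
  IsSemiProgression A = ∃[ a ] (a ∈ᴳ A × IsProgression (A - index a))

  -- Decidability of independence is automatic classically, as there are only
  -- finitely many subsets.
  record Matroid : Set₁ where
    field
      E            : SubsetOfG
      Independent  : Pred (SubsetOfG) 0ℓ
      independent? : Decidable Independent
      ground       : ∀ {I} → Independent I → I ⊆ E
      empty        : Independent ⊥
      hereditary   : ∀ {I J} → I ⊆ J → Independent J → Independent I
      augmentation : ∀ {I J} → Independent I → Independent J → ∣ I ∣ < ∣ J ∣ →
                     ∃[ e ] (e ∈ J × e ∉ I × Independent (I ∪ ⁅ e ⁆))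

    Loopless : Set
    Loopless = ∀ {e} → e ∈ E → Independent ⁅ e ⁆

    IsBasis : SubsetOfG → Set
    IsBasis B = Independent B × (∀ {I} → Independent I → B ⊆ I → I ⊆ B)

    HasRank : ℕ → Set
    HasRank n = (∃[ I ] (Independent I × ∣ I ∣ ≡ n))
              × (∀ {I} → Independent I → ∣ I ∣ ≤ n)

  open Matroid

  -- S = {a₁, …, aₙ} with the aᵢ distinct.
  Enumerates : {n : ℕ} → (Fin n → Carrier) → SubsetOfG → Set (c ⊔ ℓ)
  Enumerates a S = Injective _≡_ _≈_ a × (∀ x → x ∈ᴳ S ⇔ (∃[ i ] x ≈ a i))

  BasisMatched : Matroid → ℕ → SubsetOfG → SubsetOfG → Set (c ⊔ ℓ)
  BasisMatched M n 𝓜 𝓝 =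
    Σ[ a ∈ (Fin n → Carrier) ] Σ[ b ∈ (Fin n → Carrier) ]
      (Enumerates a 𝓜 × Enumerates b 𝓝 ×
       (Σ[ π ∈ Permutation′ n ] (∀ i → (a i + b (π ⟨$⟩ʳ i)) ∉ᴳ E M)))

  -- For matroids M and N of common rank n.
  Matched : ℕ → Matroid → Matroid → Set (c ⊔ ℓ)
  Matched n M N =
    ∀ 𝓜 → IsBasis M 𝓜 → ∃[ 𝓝 ] (IsBasis N 𝓝 × BasisMatched M n 𝓜 𝓝)

{-# OPTIONS --safe #-}
module Submission where

-- Let 𝓜 be a basis of M and 𝓝 any basis of N. If 𝓜 is not matched to 𝓝, Hall's
-- theorem gives S ⊆ 𝓜 whose set U ⊆ 𝓝 of elements incompatible with all of S
-- satisfies |S| + |U| ≥ n + 1. As 0 ∉ U, the set T = U ∪ {0} satisfies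
-- S + T ⊆ E(M) and |S| + |T| ≥ n + 2 = |E(M)| + 1. When |S| ≥ 2, a Vosper type
-- theorem, obtained from Cauchy–Davenport by Dyson transforms, forces E(M) to be
-- a progression. When S = {s}, the set U witnesses |(-s + E(M)) ∩ E(N)| = n.

open import Defs
open import Algebra.Bundles using (AbelianGroup; RawGroup)
open import Algebra.Core using (Op₁; Op₂)
import Algebra.Definitions.RawMonoid as RawMonoidDefinitions
import Algebra.Morphism.GroupMonomorphism as GroupMonomorphism
open import Algebra.Morphism.Structures using (IsGroupMonomorphism)
import Algebra.Properties.AbelianGroup as AbelianGroupProperties
open import Algebra.Structures using (IsAbelianGroup)
open import Data.Bool.Base using (if_then_else_)
open import Data.Empty using (⊥)
open import Data.Fin.Base using (Fin; zero; suc; toℕ)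
import Data.Fin.Permutation as Permutation
import Data.Fin.Properties as Fin
open import Data.Fin.Subset using (Subset; inside; outside; _∈_; _∉_; _⊆_; _⊂_; _∪_; _∩_; _─_; _-_; ⁅_⁆; ∣_∣; Nonempty; Empty)
open import Data.Fin.Subset.Induction using (⊂-wellFounded)
open import Data.Fin.Subset.Properties
open import Data.Nat.Base using (ℕ; zero; suc; _≤_; _<_; z≤n; s≤s; s≤s⁻¹)
import Data.Nat.Base as ℕ
open import Data.Nat.Properties using (+-suc; +-comm; +-identityʳ; +-mono-≤; +-monoʳ-≤; +-monoˡ-≤; +-cancelˡ-≤; ≤-refl; ≤-reflexive; ≤-trans; ≤-antisym; <⇒≤; <⇒≱; ≰⇒>; ≮⇒≥; m≤m+n; _≤?_; module ≤-Reasoning)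
open import Data.Product.Base using (∃; ∃-syntax; Σ-syntax; _×_; _,_; proj₁; proj₂)
open import Data.Sum.Base using (_⊎_; inj₁; inj₂)
open import Data.Vec.Base using ([]; _∷_; here; there; tabulate)
open import Data.Vec.Properties using (lookup∘tabulate; lookup⇒[]=; []=⇒lookup)
open import Function.Base using (_∘_)
open import Function.Bundles using (_⇔_; mk⇔; Equivalence; Inverse)
open import Induction.WellFounded using (Acc; acc)
open import Level using (Level; 0ℓ)
open import Relation.Binary.PropositionalEquality using (_≡_; _≢_; refl; sym; trans; cong; cong₂; subst)
open import Relation.Nullary using (¬_; Dec; yes; no; ¬?; contradiction)
open import Relation.Nullary.Decidable using (⌊_⌋; _×-dec_; isYes≗does; dec-true; does; decidable-stable)
open import Relation.Unary using (Pred; Decidable)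

-- The role of 0 is quantitative: |S| + |U| ≥ n + 1 falls one short of equality in the
-- Cauchy-Davenport bound |S| + |T| ≤ |E(M)| + 1, and adjoining 0 to U supplies the missing unit.
-- The inclusion S + 0 ⊆ E(M) costs nothing because S ⊆ 𝓜. Vosper's theorem is usually stated in Z/p
-- and describes both summands. Here only the shape of a set C containing A + B is wanted. This
-- suits Dyson transforms, which cannot be undone but never leave C: the pair (A, B) is replaced
-- repeatedly while C stays fixed, until B = {0, d} and C can be read off as a progression. The
-- obstacle is that a transform may collapse B to {0} and lose all information; most of the work
-- goes into finding one that keeps two elements. Outside Z/p the danger comes from subgroups. It is
-- excluded by |C| < p(G), since a nonempty set with fewer than p(G) elements is not stable under
-- any nonzero shift.

private variable
  ℓ : Level
  m k : ℕ

-- Cardinalities of finite subsets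

setOf : {P : Pred (Fin m) ℓ} → Decidable P → Subset m
setOf P? = tabulate λ i → ⌊ P? i ⌋

∈-setOf⁺ : {P : Pred (Fin m) ℓ} (P? : Decidable P) → ∀ {x} → P x → x ∈ setOf P?
∈-setOf⁺ P? {x} Px = lookup⇒[]= x _
  (trans (lookup∘tabulate _ x) (trans (isYes≗does (P? x)) (dec-true (P? x) Px)))

∈-setOf⁻ : {P : Pred (Fin m) ℓ} (P? : Decidable P) → ∀ {x} → x ∈ setOf P? → P x
∈-setOf⁻ P? {x} x∈ with P? x | trans (sym (lookup∘tabulate (λ i → ⌊ P? i ⌋) x)) ([]=⇒lookup x∈)
... | yes Px | _ = Px

x∈p─q⇒x∉q : ∀ (p q : Subset m) {x} → x ∈ p ─ q → x ∉ q
x∈p─q⇒x∉q (_ ∷ _) (outside ∷ _) {zero}  _         ()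
x∈p─q⇒x∉q (_ ∷ p) (_ ∷ q)       {suc x} (there u) (there v) = x∈p─q⇒x∉q p q u v

x∈p-y⇒x∈p : ∀ (p : Subset m) y {x} → x ∈ p - y → x ∈ p
x∈p-y⇒x∈p p y = p─q⊆p p ⁅ y ⁆

x∈p-y⇒x≢y : ∀ (p : Subset m) y {x} → x ∈ p - y → x ≢ y
x∈p-y⇒x≢y p y x∈ refl = x∈p─q⇒x∉q p ⁅ y ⁆ x∈ (x∈⁅x⁆ y)

∣p∪q∣+∣p∩q∣≡∣p∣+∣q∣ : ∀ (p q : Subset m) → ∣ p ∪ q ∣ ℕ.+ ∣ p ∩ q ∣ ≡ ∣ p ∣ ℕ.+ ∣ q ∣
∣p∪q∣+∣p∩q∣≡∣p∣+∣q∣ []            []            = refl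
∣p∪q∣+∣p∩q∣≡∣p∣+∣q∣ (outside ∷ p) (outside ∷ q) = ∣p∪q∣+∣p∩q∣≡∣p∣+∣q∣ p q
∣p∪q∣+∣p∩q∣≡∣p∣+∣q∣ (outside ∷ p) (inside ∷ q)  =
  trans (cong suc (∣p∪q∣+∣p∩q∣≡∣p∣+∣q∣ p q)) (sym (+-suc ∣ p ∣ ∣ q ∣))
∣p∪q∣+∣p∩q∣≡∣p∣+∣q∣ (inside ∷ p)  (outside ∷ q) = cong suc (∣p∪q∣+∣p∩q∣≡∣p∣+∣q∣ p q)
∣p∪q∣+∣p∩q∣≡∣p∣+∣q∣ (inside ∷ p)  (inside ∷ q)  = cong suc
  (trans (+-suc ∣ p ∪ q ∣ ∣ p ∩ q ∣)
  (trans (cong suc (∣p∪q∣+∣p∩q∣≡∣p∣+∣q∣ p q)) (sym (+-suc ∣ p ∣ ∣ q ∣))))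

∣p∪q∣≤∣p∣+∣q∣ : ∀ (p q : Subset m) → ∣ p ∪ q ∣ ≤ ∣ p ∣ ℕ.+ ∣ q ∣
∣p∪q∣≤∣p∣+∣q∣ p q = ≤-trans (m≤m+n _ _) (≤-reflexive (∣p∪q∣+∣p∩q∣≡∣p∣+∣q∣ p q))

Empty⇒∣p∣≡0 : {p : Subset m} → Empty p → ∣ p ∣ ≡ 0
Empty⇒∣p∣≡0 {m} e = trans (cong ∣_∣ (Empty-unique e)) (∣⊥∣≡0 m)

0<∣p∣⇒Nonempty : {p : Subset m} → 0 < ∣ p ∣ → Nonempty p
0<∣p∣⇒Nonempty {p = p} 0<∣p∣ with nonempty? p
... | yes p≢∅ = p≢∅
... | no e    = contradiction (≤-reflexive (Empty⇒∣p∣≡0 e)) (<⇒≱ 0<∣p∣)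

disjoint⇒∣p∪q∣≡∣p∣+∣q∣ : ∀ (p q : Subset m) → (∀ {x} → x ∈ p → x ∉ q) →
  ∣ p ∪ q ∣ ≡ ∣ p ∣ ℕ.+ ∣ q ∣
disjoint⇒∣p∪q∣≡∣p∣+∣q∣ p q p#q = trans (sym (+-identityʳ _))
  (trans (cong (∣ p ∪ q ∣ ℕ.+_) (sym (Empty⇒∣p∣≡0 p∩q=∅))) (∣p∪q∣+∣p∩q∣≡∣p∣+∣q∣ p q))
  where
  p∩q=∅ : Empty (p ∩ q)
  p∩q=∅ (x , x∈) = p#q (p∩q⊆p p q x∈) (p∩q⊆q p q x∈)

∣p∪⁅x⁆∣≡1+∣p∣ : ∀ (p : Subset m) {x} → x ∉ p → ∣ p ∪ ⁅ x ⁆ ∣ ≡ suc ∣ p ∣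
∣p∪⁅x⁆∣≡1+∣p∣ p {x} x∉p = trans
  (disjoint⇒∣p∪q∣≡∣p∣+∣q∣ p ⁅ x ⁆ λ y∈p y∈x → x∉p (subst (_∈ p) (x∈⁅y⁆⇒x≡y x y∈x) y∈p))
  (trans (cong (∣ p ∣ ℕ.+_) (∣⁅x⁆∣≡1 x)) (+-comm ∣ p ∣ 1))

∣p∣≤1+∣p-x∣ : ∀ (p : Subset m) x → ∣ p ∣ ≤ suc ∣ p - x ∣
∣p∣≤1+∣p-x∣ p x = ≤-trans (p⊆q⇒∣p∣≤∣q∣ cover) (≤-reflexive
  (∣p∪⁅x⁆∣≡1+∣p∣ (p - x) λ x∈ → x∈p-y⇒x≢y p x x∈ refl))
  where
  cover : p ⊆ (p - x) ∪ ⁅ x ⁆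
  cover {y} y∈p with y Fin.≟ x
  ... | yes refl = x∈p∪q⁺ (inj₂ (x∈⁅x⁆ x))
  ... | no y≢x   = x∈p∪q⁺ (inj₁ (x∈p∧x≢y⇒x∈p-y y∈p y≢x))

1<∣p∣⇒∃≢ : ∀ (p : Subset m) x → 1 < ∣ p ∣ → ∃[ y ] y ∈ p × y ≢ x
1<∣p∣⇒∃≢ p x 1<∣p∣ with 0<∣p∣⇒Nonempty (s≤s⁻¹ (≤-trans 1<∣p∣ (∣p∣≤1+∣p-x∣ p x)))
... | y , y∈ = y , x∈p-y⇒x∈p p x y∈ , x∈p-y⇒x≢y p x y∈

p⊆⁅x⁆⇒∣p∣≤1 : ∀ {p : Subset m} {x} → (∀ {y} → y ∈ p → y ≡ x) → ∣ p ∣ ≤ 1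
p⊆⁅x⁆⇒∣p∣≤1 {x = x} p⊆x = ≤-trans
  (p⊆q⇒∣p∣≤∣q∣ λ y∈p → subst (_∈ ⁅ x ⁆) (sym (p⊆x y∈p)) (x∈⁅x⁆ x))
  (≤-reflexive (∣⁅x⁆∣≡1 x))

∣p∣≤1⇒≡ : ∀ {p : Subset m} {x y} → ∣ p ∣ ≤ 1 → x ∈ p → y ∈ p → y ≡ x
∣p∣≤1⇒≡ {p = p} {x} {y} ∣p∣≤1 x∈p y∈p with y Fin.≟ x
... | yes y≡x = y≡x
... | no y≢x  = contradiction
  (subst (_≤ ∣ p - x ∣) (∣⁅x⁆∣≡1 y)
    (p⊆q⇒∣p∣≤∣q∣ λ z∈ → subst (_∈ p - x) (sym (x∈⁅y⁆⇒x≡y y z∈)) (x∈p∧x≢y⇒x∈p-y y∈p y≢x)))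
  (<⇒≱ (≤-trans (x∈p⇒∣p-x∣<∣p∣ x∈p) ∣p∣≤1))

InjectiveOn : Subset m → (Fin m → Fin k) → Set
InjectiveOn p f = ∀ {x y} → x ∈ p → y ∈ p → f x ≡ f y → x ≡ y

injection⇒∣p∣≤∣q∣ : ∀ (p : Subset m) (q : Subset k) (f : Fin m → Fin k) →
  InjectiveOn p f → (∀ {x} → x ∈ p → f x ∈ q) → ∣ p ∣ ≤ ∣ q ∣
injection⇒∣p∣≤∣q∣ []            q f inj p→q = z≤n
injection⇒∣p∣≤∣q∣ (outside ∷ p) q f inj p→q = injection⇒∣p∣≤∣q∣ p q (f ∘ suc)
  (λ x∈ y∈ eq → Fin.suc-injective (inj (there x∈) (there y∈) eq)) (p→q ∘ there)
injection⇒∣p∣≤∣q∣ (inside ∷ p)  q f inj p→q = ≤-trans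
  (s≤s (injection⇒∣p∣≤∣q∣ p (q - f zero) (f ∘ suc)
    (λ x∈ y∈ eq → Fin.suc-injective (inj (there x∈) (there y∈) eq))
    (λ x∈ → x∈p∧x≢y⇒x∈p-y (p→q (there x∈))
      λ eq → Fin.0≢1+n (sym (inj (there x∈) here eq)))))
  (x∈p⇒∣p-x∣<∣p∣ (p→q here))

injection⇒surjection : ∀ (p : Subset m) (q : Subset k) (f : Fin m → Fin k) →
  InjectiveOn p f → (∀ {x} → x ∈ p → f x ∈ q) → ∣ q ∣ ≤ ∣ p ∣ →
  ∀ {y} → y ∈ q → ∃[ x ] x ∈ p × f x ≡ y
injection⇒surjection p q f inj p→q ∣q∣≤∣p∣ {y} y∈q
  with Fin.any? (λ x → (x ∈? p) ×-dec (f x Fin.≟ y))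
... | yes hit = hit
... | no miss = contradiction ∣q∣≤∣p∣ (<⇒≱ (≤-trans
  (s≤s (injection⇒∣p∣≤∣q∣ p (q - y) f inj
    λ {x} x∈p → x∈p∧x≢y⇒x∈p-y (p→q x∈p) λ eq → miss (x , x∈p , eq)))
  (x∈p⇒∣p-x∣<∣p∣ y∈q)))

p⊆q∧∣q∣≤∣p∣⇒q⊆p : {p q : Subset m} → p ⊆ q → ∣ q ∣ ≤ ∣ p ∣ → q ⊆ p
p⊆q∧∣q∣≤∣p∣⇒q⊆p {p = p} {q} p⊆q ∣q∣≤∣p∣ y∈q
  with injection⇒surjection p q (λ x → x) (λ _ _ eq → eq) p⊆q ∣q∣≤∣p∣ y∈q
... | _ , x∈p , refl = x∈p

enumerate : (p : Subset m) → Fin ∣ p ∣ → Fin m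
enumerate (outside ∷ p) i       = suc (enumerate p i)
enumerate (inside ∷ p)  zero    = zero
enumerate (inside ∷ p)  (suc i) = suc (enumerate p i)

enumerate-injective : ∀ (p : Subset m) {i j} → enumerate p i ≡ enumerate p j → i ≡ j
enumerate-injective (outside ∷ p)                 eq = enumerate-injective p (Fin.suc-injective eq)
enumerate-injective (inside ∷ p) {zero}  {zero}  eq = refl
enumerate-injective (inside ∷ p) {suc i} {suc j} eq = cong suc (enumerate-injective p (Fin.suc-injective eq))

enumerate-∈ : ∀ (p : Subset m) i → enumerate p i ∈ p
enumerate-∈ (outside ∷ p) i       = there (enumerate-∈ p i)
enumerate-∈ (inside ∷ p)  zero    = here
enumerate-∈ (inside ∷ p)  (suc i) = there (enumerate-∈ p i)

enumerate-surjective : ∀ (p : Subset m) {x} → x ∈ p → ∃[ i ] enumerate p i ≡ x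
enumerate-surjective (inside ∷ p)  here       = zero , refl
enumerate-surjective (inside ∷ p)  (there x∈) with enumerate-surjective p x∈
... | i , eq = suc i , cong suc eq
enumerate-surjective (outside ∷ p) (there x∈) with enumerate-surjective p x∈
... | i , eq = i , cong suc eq

-- Hall's marriage theorem

module _ (nbr : Fin m → Subset k) where

  neighbour? : ∀ S (y : Fin k) → Dec (∃[ x ] x ∈ S × y ∈ nbr x)
  neighbour? S y = Fin.any? λ x → (x ∈? S) ×-dec (y ∈? nbr x)

  neighbours : Subset m → Subset k
  neighbours S = setOf (neighbour? S)

  ∈-neighbours⁺ : ∀ {S x y} → x ∈ S → y ∈ nbr x → y ∈ neighbours S
  ∈-neighbours⁺ {S} {x} x∈S y∈ = ∈-setOf⁺ (neighbour? S) (x , x∈S , y∈)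

  ∈-neighbours⁻ : ∀ {S y} → y ∈ neighbours S → ∃[ x ] x ∈ S × y ∈ nbr x
  ∈-neighbours⁻ {S} = ∈-setOf⁻ (neighbour? S)

  HallCondition : Subset m → Set
  HallCondition X = ∀ {S} → S ⊆ X → ∣ S ∣ ≤ ∣ neighbours S ∣

  Matching : Subset m → (Fin m → Fin k) → Set
  Matching X f = InjectiveOn X f × (∀ {x} → x ∈ X → f x ∈ nbr x)

  -- Properness makes `S` a smaller instance of the problem, and nonemptiness makes `X ─ S` one.
  -- Under `HallCondition` the inequality is an equality.
  Tight : Subset m → Subset m → Set
  Tight X S = S ⊂ X × Nonempty S × ∣ neighbours S ∣ ≤ ∣ S ∣

  tight? : ∀ X → Dec (∃[ S ] Tight X S)
  tight? X = anySubset? λ S → (S ⊂? X) ×-dec nonempty? S ×-dec (∣ neighbours S ∣ ≤? ∣ S ∣)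

module _ (nbr : Fin m → Subset k) {X S : Subset m} where

  outsideNeighbours : Fin m → Subset k
  outsideNeighbours x = nbr x ─ neighbours nbr S

  -- Hall's condition for `S ∪ T` leaves enough neighbours for `T` once those of `S` are discounted,
  -- because they number at most |S|.
  tight-residual : HallCondition nbr X → Tight nbr X S →
    HallCondition outsideNeighbours (X ─ S)
  tight-residual hall ((S⊆X , _) , _ , tight) {T} T⊆ = +-cancelˡ-≤ ∣ S ∣ _ _ (begin
    ∣ S ∣ ℕ.+ ∣ T ∣                                              ≡⟨ disjoint⇒∣p∪q∣≡∣p∣+∣q∣ S T (λ x∈S x∈T → x∈p─q⇒x∉q X S (T⊆ x∈T) x∈S) ⟨
    ∣ S ∪ T ∣                                                    ≤⟨ hall S∪T⊆X ⟩
    ∣ neighbours nbr (S ∪ T) ∣                                   ≤⟨ p⊆q⇒∣p∣≤∣q∣ cover ⟩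
    ∣ neighbours nbr S ∪ neighbours outsideNeighbours T ∣        ≤⟨ ∣p∪q∣≤∣p∣+∣q∣ (neighbours nbr S) _ ⟩
    ∣ neighbours nbr S ∣ ℕ.+ ∣ neighbours outsideNeighbours T ∣  ≤⟨ +-monoˡ-≤ _ tight ⟩
    ∣ S ∣ ℕ.+ ∣ neighbours outsideNeighbours T ∣                 ∎)
    where
    open ≤-Reasoning
    S∪T⊆X : S ∪ T ⊆ X
    S∪T⊆X x∈ with x∈p∪q⁻ S T x∈
    ... | inj₁ x∈S = S⊆X x∈S
    ... | inj₂ x∈T = p─q⊆p X S (T⊆ x∈T)
    cover : neighbours nbr (S ∪ T) ⊆ neighbours nbr S ∪ neighbours outsideNeighbours T
    cover {y} y∈ with y ∈? neighbours nbr S | ∈-neighbours⁻ nbr y∈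
    ... | yes y∈NS | _ = x∈p∪q⁺ (inj₁ y∈NS)
    ... | no  y∉NS | x , x∈ , y∈x with x∈p∪q⁻ S T x∈
    ...   | inj₁ x∈S = contradiction (∈-neighbours⁺ nbr x∈S y∈x) y∉NS
    ...   | inj₂ x∈T = x∈p∪q⁺ (inj₂ (∈-neighbours⁺ outsideNeighbours x∈T (x∈p∧x∉q⇒x∈p─q y∈x y∉NS)))

  glue-matchings : ∀ {f g} → Matching nbr S f → Matching outsideNeighbours (X ─ S) g →
    ∃ (Matching nbr X)
  glue-matchings {f} {g} (f-inj , f∈) (g-inj , g∈) = h , h-inj , h∈
    where
    h : Fin m → Fin k
    h x = if does (x ∈? S) then f x else g x
    h∈ : ∀ {x} → x ∈ X → h x ∈ nbr x
    h∈ {x} x∈X with x ∈? S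
    ... | yes x∈S = f∈ x∈S
    ... | no  x∉S = p─q⊆p (nbr x) _ (g∈ (x∈p∧x∉q⇒x∈p─q x∈X x∉S))
    f≢g : ∀ {x y} → x ∈ S → y ∈ X → y ∉ S → f x ≢ g y
    f≢g {x} {y} x∈S y∈X y∉S eq = x∈p─q⇒x∉q (nbr y) _ (g∈ (x∈p∧x∉q⇒x∈p─q y∈X y∉S))
      (subst (_∈ neighbours nbr S) eq (∈-neighbours⁺ nbr x∈S (f∈ x∈S)))
    h-inj : InjectiveOn X h
    h-inj {x} {y} x∈X y∈X eq with x ∈? S | y ∈? S
    ... | yes x∈S | yes y∈S = f-inj x∈S y∈S eq
    ... | yes x∈S | no  y∉S = contradiction eq (f≢g x∈S y∈X y∉S)
    ... | no  x∉S | yes y∈S = contradiction (sym eq) (f≢g y∈S x∈X x∉S)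
    ... | no  x∉S | no  y∉S = g-inj (x∈p∧x∉q⇒x∈p─q x∈X x∉S) (x∈p∧x∉q⇒x∈p─q y∈X y∉S) eq

module _ (nbr : Fin m → Subset k) {X : Subset m} {x : Fin m} {y : Fin k} where

  avoidingNeighbours : Fin m → Subset k
  avoidingNeighbours z = nbr z - y

  -- Without tight sets every nonempty proper subset of `X` has a neighbour to spare, which pays for
  -- the loss of `y`. Subsets of `X - x` are proper as they miss `x`.
  avoiding-residual : x ∈ X → ¬ (∃[ S ] Tight nbr X S) →
    HallCondition avoidingNeighbours (X - x)
  avoiding-residual x∈X ¬tight {T} T⊆ with nonempty? T
  ... | no  T=∅ = ≤-trans (≤-reflexive (Empty⇒∣p∣≡0 T=∅)) z≤n
  ... | yes T≢∅ = s≤s⁻¹ (begin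
    suc ∣ T ∣                     ≤⟨ ≰⇒> (λ tight → ¬tight (T , T⊂X , T≢∅ , tight)) ⟩
    ∣ neighbours nbr T ∣          ≤⟨ ∣p∣≤1+∣p-x∣ (neighbours nbr T) y ⟩
    suc ∣ neighbours nbr T - y ∣  ≤⟨ s≤s (p⊆q⇒∣p∣≤∣q∣ cover) ⟩
    suc ∣ neighbours avoidingNeighbours T ∣  ∎)
    where
    open ≤-Reasoning
    T⊂X : T ⊂ X
    T⊂X = (λ z∈T → x∈p-y⇒x∈p X x (T⊆ z∈T)) , x , x∈X , λ x∈T → x∈p-y⇒x≢y X x (T⊆ x∈T) refl
    cover : neighbours nbr T - y ⊆ neighbours avoidingNeighbours T
    cover w∈ with ∈-neighbours⁻ nbr (x∈p-y⇒x∈p _ y w∈)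
    ... | z , z∈T , w∈z = ∈-neighbours⁺ avoidingNeighbours z∈T
      (x∈p∧x≢y⇒x∈p-y w∈z (x∈p-y⇒x≢y (neighbours nbr T) y w∈))

  extend-matching : ∀ {f} → y ∈ nbr x → Matching avoidingNeighbours (X - x) f →
    ∃ (Matching nbr X)
  extend-matching {f} y∈x (f-inj , f∈) = h , h-inj , h∈
    where
    h : Fin m → Fin k
    h z = if does (z Fin.≟ x) then y else f z
    h∈ : ∀ {z} → z ∈ X → h z ∈ nbr z
    h∈ {z} z∈X with z Fin.≟ x
    ... | yes refl = y∈x
    ... | no  z≢x  = x∈p-y⇒x∈p (nbr z) y (f∈ (x∈p∧x≢y⇒x∈p-y z∈X z≢x))
    f≢y : ∀ {z} → z ∈ X → z ≢ x → f z ≢ y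
    f≢y {z} z∈X z≢x = x∈p-y⇒x≢y (nbr z) y (f∈ (x∈p∧x≢y⇒x∈p-y z∈X z≢x))
    h-inj : InjectiveOn X h
    h-inj {z} {w} z∈X w∈X eq with z Fin.≟ x | w Fin.≟ x
    ... | yes refl | yes refl = refl
    ... | yes _    | no  w≢x  = contradiction (sym eq) (f≢y w∈X w≢x)
    ... | no  z≢x  | yes _    = contradiction eq (f≢y z∈X z≢x)
    ... | no  z≢x  | no  w≢x  = f-inj (x∈p∧x≢y⇒x∈p-y z∈X z≢x) (x∈p∧x≢y⇒x∈p-y w∈X w≢x) eq

-- The Halmos–Vaughan induction. The element y₀ only serves as the value of the
-- matching outside X.
hall-acc : Fin k → (nbr : Fin m → Subset k) {X : Subset m} → Acc _⊂_ X →
  HallCondition nbr X → ∃ (Matching nbr X)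
hall-acc y₀ nbr {X} (acc rec) hall with nonempty? X
... | no  X=∅ = (λ _ → y₀) , (λ {x} x∈X → contradiction (x , x∈X) X=∅) , λ {x} x∈X → contradiction (x , x∈X) X=∅
... | yes (x , x∈X) with tight? nbr X
...   | yes (S , S⊂X@(S⊆X , _) , (s , s∈S) , tight) =
  let S≢∅ = s , s∈S
      f , f-matching = hall-acc y₀ nbr (rec S⊂X) (λ T⊆S → hall (λ x∈T → S⊆X (T⊆S x∈T)))
      g , g-matching = hall-acc y₀ (outsideNeighbours nbr {X} {S})
        (rec (p∩q≢∅⇒p─q⊂p X S (s , x∈p∩q⁺ (S⊆X s∈S , s∈S))))
        (tight-residual nbr hall (S⊂X , S≢∅ , tight))
  in glue-matchings nbr f-matching g-matching
-- Hall's condition for the singleton of `x` provides a neighbour; in the absence of tight sets any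
-- neighbour will do.
...   | no ¬tight with 0<∣p∣⇒Nonempty (subst (_≤ ∣ neighbours nbr ⁅ x ⁆ ∣) (∣⁅x⁆∣≡1 x)
          (hall (λ z∈ → subst (_∈ X) (sym (x∈⁅y⁆⇒x≡y x z∈)) x∈X)))
...     | y , y∈N with ∈-neighbours⁻ nbr y∈N
...       | z , z∈ , y∈z =
  let f , f-matching = hall-acc y₀ (avoidingNeighbours nbr {X} {x} {y}) (rec (x∈p⇒p-x⊂p x∈X))
        (avoiding-residual nbr x∈X ¬tight)
  in extend-matching nbr (subst (λ w → y ∈ nbr w) (x∈⁅y⁆⇒x≡y x z∈) y∈z) f-matching

hall : Fin k → (nbr : Fin m → Subset k) {X : Subset m} →
  HallCondition nbr X → ∃ (Matching nbr X)
hall y₀ nbr {X} = hall-acc y₀ nbr (⊂-wellFounded X)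

-- The theorems of Cauchy–Davenport and Vosper

module Sumsets {m : ℕ} (_+_ : Op₂ (Fin m)) (0# : Fin m) (⊝_ : Op₁ (Fin m))
  (isAbelianGroup : IsAbelianGroup _≡_ _+_ 0# ⊝_) where

  𝔾 : AbelianGroup 0ℓ 0ℓ
  𝔾 = record { isAbelianGroup = isAbelianGroup }

  open IsAbelianGroup isAbelianGroup using (assoc; comm; identityˡ; identityʳ)
  open AbelianGroupProperties 𝔾 using (∙-cancelˡ; ∙-cancelʳ; xyx⁻¹≈y; x∙y⁻¹≈ε⇒x≈y)
  open RawMonoidDefinitions (AbelianGroup.rawMonoid 𝔾) public using () renaming (_×_ to infixr 8 _·_)

  infixl 6 _⊖_
  _⊖_ : Op₂ (Fin m)
  x ⊖ y = x + (⊝ y)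

  ⊖-cancel : ∀ x e → e + (x ⊖ e) ≡ x
  ⊖-cancel x e = trans (sym (assoc e x (⊝ e))) (xyx⁻¹≈y e x)

  x+y≡z⇒y≡z⊖x : ∀ {x y z} → x + y ≡ z → y ≡ z ⊖ x
  x+y≡z⇒y≡z⊖x {x} {y} refl = sym (xyx⁻¹≈y x y)

  +-exchange : ∀ x y e → (x ⊖ e) + y ≡ (y ⊖ e) + x
  +-exchange x y e = trans (assoc x (⊝ e) y) (trans (comm x _) (cong (_+ x) (comm (⊝ e) y)))

  record IsSubgroup (H : Subset m) : Set where
    field
      0∈       : 0# ∈ H
      +-closed : ∀ {x y} → x ∈ H → y ∈ H → x + y ∈ H
      -‿closed : ∀ {x} → x ∈ H → ⊝ x ∈ H

  Progression : Subset m → Set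
  Progression A = ∃[ k ] ∃[ a ] ∃[ d ] (∀ x → x ∈ A ⇔ (Σ[ i ∈ Fin (suc k) ] x ≡ a + (toℕ i · d)))

  -- An inclusion instead of the exact sumset: a transform may shrink A + B, whereas a fixed `C`
  -- remains an upper bound.
  _⊞_⊆_ : Subset m → Subset m → Subset m → Set
  A ⊞ B ⊆ C = ∀ {a b} → a ∈ A → b ∈ B → a + b ∈ C

  -- Stabilisers of finite sets

  stabilises? : ∀ A g → Dec (∀ {x} → x ∈ A → g + x ∈ A)
  stabilises? A g with Fin.any? (λ x → (x ∈? A) ×-dec ¬? (g + x ∈? A))
  ... | yes (x , x∈A , gx∉A) = no λ stab → gx∉A (stab x∈A)
  ... | no  none             = yes λ {x} x∈A → decidable-stable (g + x ∈? A) λ gx∉A → none (x , x∈A , gx∉A)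

  stabiliser : Subset m → Subset m
  stabiliser A = setOf (stabilises? A)

  stabiliser-isSubgroup : ∀ A → IsSubgroup (stabiliser A)
  stabiliser-isSubgroup A = record
    { 0∈       = ∈-setOf⁺ (stabilises? A) λ {x} → subst (_∈ A) (sym (identityˡ x))
    ; +-closed = λ {g} {h} g∈ h∈ → ∈-setOf⁺ (stabilises? A) λ {x} x∈A →
        subst (_∈ A) (sym (assoc g h x))
          (∈-setOf⁻ (stabilises? A) g∈ (∈-setOf⁻ (stabilises? A) h∈ x∈A))
    ; -‿closed = λ g∈ → ∈-setOf⁺ (stabilises? A) (shift-back (∈-setOf⁻ (stabilises? A) g∈))
    }
    where
    -- An injective map of the finite set `A` into itself is onto, so the inverse shift also
    -- preserves `A`.
    shift-back : ∀ {g} → (∀ {x} → x ∈ A → g + x ∈ A) → ∀ {x} → x ∈ A → (⊝ g) + x ∈ A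
    shift-back {g} stab {y} y∈A
      with injection⇒surjection A A (g +_) (λ {x} {y} _ _ → ∙-cancelˡ g x y) stab ≤-refl y∈A
    ... | x , x∈A , gx≡y = subst (_∈ A) (trans (x+y≡z⇒y≡z⊖x gx≡y) (comm y (⊝ g))) x∈A

  -- Dyson transforms

  translate : Fin m → Subset m → Subset m
  translate e B = setOf λ x → (x ⊖ e) ∈? B

  ∣translate∣ : ∀ e B → ∣ translate e B ∣ ≡ ∣ B ∣
  ∣translate∣ e B = ≤-antisym
    (injection⇒∣p∣≤∣q∣ (translate e B) B (_⊖ e) (λ {x} {y} _ _ → ∙-cancelʳ (⊝ e) x y)
      (∈-setOf⁻ λ x → (x ⊖ e) ∈? B))
    (injection⇒∣p∣≤∣q∣ B (translate e B) (e +_) (λ {x} {y} _ _ → ∙-cancelˡ e x y)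
      λ {x} x∈B → ∈-setOf⁺ (λ x → (x ⊖ e) ∈? B) (subst (_∈ B) (sym (xyx⁻¹≈y e x)) x∈B))

  -- Together with `dysonʳ` this is the Dyson e-transform: `A` grows to A ∪ (e + B), and `B` shrinks
  -- to B ∩ (-e + A).
  dysonˡ : Fin m → Subset m → Subset m → Subset m
  dysonˡ e A B = A ∪ translate e B

  dysonʳ? : ∀ e A B x → Dec (x ∈ B × e + x ∈ A)
  dysonʳ? e A B x = (x ∈? B) ×-dec (e + x ∈? A)

  dysonʳ : Fin m → Subset m → Subset m → Subset m
  dysonʳ e A B = setOf (dysonʳ? e A B)

  ∈-dysonˡ⁻ : ∀ {e A B x} → x ∈ dysonˡ e A B → x ∈ A ⊎ x ⊖ e ∈ B
  ∈-dysonˡ⁻ {e} {A} {B} x∈ with x∈p∪q⁻ A (translate e B) x∈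
  ... | inj₁ x∈A  = inj₁ x∈A
  ... | inj₂ x∈eB = inj₂ (∈-setOf⁻ (λ x → (x ⊖ e) ∈? B) x∈eB)

  ∈-dysonʳ⁻ : ∀ {e A B x} → x ∈ dysonʳ e A B → x ∈ B × e + x ∈ A
  ∈-dysonʳ⁻ {e} {A} {B} = ∈-setOf⁻ (dysonʳ? e A B)

  ∈-dysonʳ⁺ : ∀ {e A B x} → x ∈ B → e + x ∈ A → x ∈ dysonʳ e A B
  ∈-dysonʳ⁺ {e} {A} {B} x∈B ex∈A = ∈-setOf⁺ (dysonʳ? e A B) (x∈B , ex∈A)

  0∈dysonʳ : ∀ {e A B} → e ∈ A → 0# ∈ B → 0# ∈ dysonʳ e A B
  0∈dysonʳ {e} {A} e∈A 0∈B = ∈-dysonʳ⁺ 0∈B (subst (_∈ A) (sym (identityʳ e)) e∈A)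

  dysonʳ-⊂ : ∀ {e A B b} → b ∈ B → e + b ∉ A → dysonʳ e A B ⊂ B
  dysonʳ-⊂ b∈B eb∉A = (proj₁ ∘ ∈-dysonʳ⁻) , _ , b∈B , eb∉A ∘ proj₂ ∘ ∈-dysonʳ⁻

  -- The only new case is x ∈ e + B with e + y ∈ A. Moving `e` from one summand to the other writes
  -- x + y as (e + y) + (x - e), a sum from A + B.
  dyson-sums : ∀ {e A B C} → A ⊞ B ⊆ C → dysonˡ e A B ⊞ dysonʳ e A B ⊆ C
  dyson-sums {e} {A} {B} {C} A+B⊆C {x} {y} x∈ y∈ with ∈-dysonˡ⁻ x∈ | ∈-dysonʳ⁻ y∈
  ... | inj₁ x∈A  | y∈B , _    = A+B⊆C x∈A y∈B
  ... | inj₂ xe∈B | _ , ey∈A = subst (_∈ C) eq (A+B⊆C ey∈A xe∈B)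
    where
    eq : (e + y) + (x ⊖ e) ≡ x + y
    eq = trans (cong (_+ (x ⊖ e)) (comm e y)) (trans (assoc y e _)
      (trans (cong (y +_) (⊖-cancel x e)) (comm y x)))

  -- Inclusion-exclusion for `A` and e + B, whose intersection is the translate by `e` of
  -- `dysonʳ e A B`.
  dyson-size : ∀ e A B → ∣ A ∣ ℕ.+ ∣ B ∣ ≤ ∣ dysonˡ e A B ∣ ℕ.+ ∣ dysonʳ e A B ∣
  dyson-size e A B = begin
    ∣ A ∣ ℕ.+ ∣ B ∣                             ≡⟨ cong (∣ A ∣ ℕ.+_) (∣translate∣ e B) ⟨
    ∣ A ∣ ℕ.+ ∣ translate e B ∣                 ≡⟨ ∣p∪q∣+∣p∩q∣≡∣p∣+∣q∣ A (translate e B) ⟨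
    ∣ dysonˡ e A B ∣ ℕ.+ ∣ A ∩ translate e B ∣  ≤⟨ +-monoʳ-≤ ∣ dysonˡ e A B ∣ A∩eB≤ ⟩
    ∣ dysonˡ e A B ∣ ℕ.+ ∣ dysonʳ e A B ∣       ∎
    where
    open ≤-Reasoning
    A∩eB≤ : ∣ A ∩ translate e B ∣ ≤ ∣ dysonʳ e A B ∣
    A∩eB≤ = injection⇒∣p∣≤∣q∣ _ (dysonʳ e A B) (_⊖ e) (λ {x} {y} _ _ → ∙-cancelʳ (⊝ e) x y)
      λ {x} x∈ → ∈-dysonʳ⁺ (∈-setOf⁻ (λ x → (x ⊖ e) ∈? B) (p∩q⊆q A _ x∈))
        (subst (_∈ A) (sym (⊖-cancel x e)) (p∩q⊆p A _ x∈))

  ⊞⊆⇒⊆ : ∀ {A B C} → 0# ∈ B → A ⊞ B ⊆ C → A ⊆ C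
  ⊞⊆⇒⊆ {C = C} 0∈B A+B⊆C {x} x∈A = subst (_∈ C) (identityʳ x) (A+B⊆C x∈A 0∈B)

  -- Sumsets smaller than every nonzero subgroup

  module _ {p : ℕ} (p-minimal : ∀ {H d} → IsSubgroup H → d ∈ H → d ≢ 0# → p ≤ ∣ H ∣) where

    -- The stabiliser of `A` is a subgroup containing d ≠ 0, and g ↦ g + a embeds it into `A`.
    periodic⇒p≤∣A∣ : ∀ {A d} → Nonempty A → d ≢ 0# → (∀ {x} → x ∈ A → d + x ∈ A) → p ≤ ∣ A ∣
    periodic⇒p≤∣A∣ {A} (a , a∈A) d≢0 stab = ≤-trans
      (p-minimal (stabiliser-isSubgroup A) (∈-setOf⁺ (stabilises? A) stab) d≢0)
      (injection⇒∣p∣≤∣q∣ (stabiliser A) A (_+ a) (λ {x} {y} _ _ → ∙-cancelʳ a x y)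
        λ g∈ → ∈-setOf⁻ (stabilises? A) g∈ a∈A)

    escape : ∀ {A d} → Nonempty A → d ≢ 0# → ∣ A ∣ < p → ∃[ a ] a ∈ A × d + a ∉ A
    escape {A} {d} A≢∅ d≢0 ∣A∣<p with Fin.any? (λ x → (x ∈? A) ×-dec ¬? (d + x ∈? A))
    ... | yes found = found
    ... | no  none  = contradiction
      (periodic⇒p≤∣A∣ A≢∅ d≢0 λ {x} x∈A → decidable-stable (d + x ∈? A) λ dx∉A → none (x , x∈A , dx∉A))
      (<⇒≱ ∣A∣<p)

    -- A transform at `e` shrinks `B` as soon as e + B leaves `A`. If this happens for no e ∈ A,
    -- every element of `B` shifts `A` into itself, and `escape` leaves only 0 in `B`. The condition
    -- 0 ∈ B survives each transform and keeps `A` inside `C`.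
    cauchy-davenport-acc : ∀ {A B C} → Acc _⊂_ B → Nonempty A → 0# ∈ B → A ⊞ B ⊆ C →
      ∣ C ∣ < p → ∣ A ∣ ℕ.+ ∣ B ∣ ≤ suc ∣ C ∣
    cauchy-davenport-acc {A} {B} {C} (acc rec) (a , a∈A) 0∈B A+B⊆C ∣C∣<p
      with Fin.any? (λ e → (e ∈? A) ×-dec Fin.any? (λ b → (b ∈? B) ×-dec ¬? (e + b ∈? A)))
    ... | yes (e , e∈A , b , b∈B , eb∉A) = ≤-trans (dyson-size e A B)
      (cauchy-davenport-acc (rec (dysonʳ-⊂ b∈B eb∉A)) (a , p⊆p∪q _ a∈A)
        (0∈dysonʳ e∈A 0∈B) (dyson-sums A+B⊆C) ∣C∣<p)
    ... | no none = ≤-trans (+-mono-≤ ∣A∣≤∣C∣ (p⊆⁅x⁆⇒∣p∣≤1 B⊆0)) (≤-reflexive (+-comm ∣ C ∣ 1))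
      where
      ∣A∣≤∣C∣ : ∣ A ∣ ≤ ∣ C ∣
      ∣A∣≤∣C∣ = p⊆q⇒∣p∣≤∣q∣ (⊞⊆⇒⊆ 0∈B A+B⊆C)
      B⊆0 : ∀ {b} → b ∈ B → b ≡ 0#
      B⊆0 {b} b∈B with b Fin.≟ 0#
      ... | yes b≡0 = b≡0
      ... | no  b≢0 with escape (a , a∈A) b≢0 (≤-trans (s≤s ∣A∣≤∣C∣) ∣C∣<p)
      ...   | e , e∈A , be∉A = contradiction
        (e , e∈A , b , b∈B , subst (_∉ A) (comm b e) be∉A) none

    cauchy-davenport : ∀ {A B C} → Nonempty A → 0# ∈ B → A ⊞ B ⊆ C →
      ∣ C ∣ < p → ∣ A ∣ ℕ.+ ∣ B ∣ ≤ suc ∣ C ∣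
    cauchy-davenport {B = B} = cauchy-davenport-acc (⊂-wellFounded B)

    -- By periodicity z ⊖ d ∈ A; once it is removed from A, it takes over the role
    -- of z as the only exit of the shift by d.
    chain : ∀ {A d z} → Acc _⊂_ A → d ≢ 0# → ∣ A ∣ < p → z ∉ A →
      (∀ {x} → x ∈ A → d + x ∉ A → d + x ≡ z) →
      ∃[ k ] (∀ x → (x ∈ A ⊎ x ≡ z) ⇔ (Σ[ i ∈ Fin (suc k) ] x ≡ z + (toℕ i · (⊝ d))))
    chain {A} {d} {z} (acc rec) d≢0 ∣A∣<p z∉A exit with nonempty? A
    ... | no A=∅ = 0 , λ x → mk⇔
      (λ { (inj₁ x∈A) → contradiction (x , x∈A) A=∅ ; (inj₂ refl) → zero , sym (identityʳ z) })
      (λ { (zero , eq) → inj₂ (trans eq (identityʳ z)) })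
    ... | yes A≢∅ with escape A≢∅ d≢0 ∣A∣<p
    ...   | y , y∈A , dy∉A with x+y≡z⇒y≡z⊖x (exit y∈A dy∉A)
    ...     | refl with chain (rec (x∈p⇒p-x⊂p y∈A)) d≢0
                        (≤-trans (s≤s (<⇒≤ (x∈p⇒∣p-x∣<∣p∣ y∈A))) ∣A∣<p)
                        (λ y∈ → x∈p-y⇒x≢y A y y∈ refl) exit′
      where
      exit′ : ∀ {x} → x ∈ A - y → d + x ∉ A - y → d + x ≡ y
      exit′ {x} x∈ dx∉ with d + x Fin.≟ y
      ... | yes dx≡y = dx≡y
      ... | no  dx≢y = contradiction
        (x+y≡z⇒y≡z⊖x (exit (x∈p-y⇒x∈p A y x∈) (λ dx∈A → dx∉ (x∈p∧x≢y⇒x∈p-y dx∈A dx≢y))))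
        (x∈p-y⇒x≢y A y x∈)
    ...       | k , iff = suc k , λ x → mk⇔ (to x) (from x)
      where
      shift : ∀ i → y + (i · (⊝ d)) ≡ z + (suc i · (⊝ d))
      shift i = assoc z (⊝ d) (i · (⊝ d))
      to : ∀ x → x ∈ A ⊎ x ≡ z → Σ[ i ∈ Fin (suc (suc k)) ] x ≡ z + (toℕ i · (⊝ d))
      to′ : ∀ x → x ∈ A - y ⊎ x ≡ y → Σ[ i ∈ Fin (suc (suc k)) ] x ≡ z + (toℕ i · (⊝ d))
      to′ x x∈ with Equivalence.to (iff x) x∈
      ... | i , eq = suc i , trans eq (shift (toℕ i))
      to x (inj₂ refl) = zero , sym (identityʳ z)
      to x (inj₁ x∈A) with x Fin.≟ y
      ... | yes x≡y = to′ x (inj₂ x≡y)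
      ... | no  x≢y = to′ x (inj₁ (x∈p∧x≢y⇒x∈p-y x∈A x≢y))
      from : ∀ x → Σ[ i ∈ Fin (suc (suc k)) ] x ≡ z + (toℕ i · (⊝ d)) → x ∈ A ⊎ x ≡ z
      from x (zero  , eq) = inj₂ (trans eq (identityʳ z))
      from x (suc i , eq) with Equivalence.from (iff x) (i , trans eq (sym (shift (toℕ i))))
      ... | inj₁ x∈   = inj₁ (x∈p-y⇒x∈p A y x∈)
      ... | inj₂ refl = inj₁ y∈A

    -- Equality in Cauchy-Davenport

    module _ {A B C : Subset m} (0∈B : 0# ∈ B) (A+B⊆C : A ⊞ B ⊆ C) (∣C∣<p : ∣ C ∣ < p)
      (1<∣A∣ : 1 < ∣ A ∣) (1<∣B∣ : 1 < ∣ B ∣) (critical : suc ∣ C ∣ ≤ ∣ A ∣ ℕ.+ ∣ B ∣) where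

      private
        A≢∅ : Nonempty A
        A≢∅ = 0<∣p∣⇒Nonempty (<⇒≤ 1<∣A∣)

        ∣A∣<p : ∣ A ∣ < p
        ∣A∣<p = ≤-trans (s≤s (p⊆q⇒∣p∣≤∣q∣ (⊞⊆⇒⊆ 0∈B A+B⊆C))) ∣C∣<p

      -- Here B = {0, d}, and criticality gives |C| ≤ |A| + 1. So `C` is `A` with one further point
      -- `z`, the only place where the shift by `d` leaves `A`, as `chain` requires.
      vosper-pair : ∣ B ∣ ≤ 2 → Progression C
      vosper-pair ∣B∣≤2 with 1<∣p∣⇒∃≢ B 0# 1<∣B∣
      ... | d , d∈B , d≢0 with escape A≢∅ d≢0 ∣A∣<p
      -- The progression is read backwards from its exit point `z`, hence the difference -d.
      ...   | e , e∈A , z∉A = proj₁ P , z , ⊝ d , λ x → mk⇔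
        (λ x∈C → Equivalence.to (proj₂ P x) (split x∈C))
        (λ i → join (Equivalence.from (proj₂ P x) i))
        where
        z : Fin m
        z = d + e
        d+A⊆C : ∀ {x} → x ∈ A → d + x ∈ C
        d+A⊆C {x} x∈A = subst (_∈ C) (comm x d) (A+B⊆C x∈A d∈B)
        join : ∀ {x} → x ∈ A ⊎ x ≡ z → x ∈ C
        join (inj₁ x∈A)  = ⊞⊆⇒⊆ 0∈B A+B⊆C x∈A
        join (inj₂ refl) = d+A⊆C e∈A
        A∪z⊆C : A ∪ ⁅ z ⁆ ⊆ C
        A∪z⊆C x∈ with x∈p∪q⁻ A ⁅ z ⁆ x∈
        ... | inj₁ x∈A = join (inj₁ x∈A)
        ... | inj₂ x∈z = join (inj₂ (x∈⁅y⁆⇒x≡y z x∈z))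
        ∣C∣≤∣A∪z∣ : ∣ C ∣ ≤ ∣ A ∪ ⁅ z ⁆ ∣
        ∣C∣≤∣A∪z∣ = s≤s⁻¹ (begin
          suc ∣ C ∣        ≤⟨ critical ⟩
          ∣ A ∣ ℕ.+ ∣ B ∣  ≤⟨ +-monoʳ-≤ ∣ A ∣ ∣B∣≤2 ⟩
          ∣ A ∣ ℕ.+ 2      ≡⟨ +-comm ∣ A ∣ 2 ⟩
          2 ℕ.+ ∣ A ∣      ≡⟨ cong suc (∣p∪⁅x⁆∣≡1+∣p∣ A z∉A) ⟨
          suc ∣ A ∪ ⁅ z ⁆ ∣  ∎)
          where open ≤-Reasoning
        split : ∀ {x} → x ∈ C → x ∈ A ⊎ x ≡ z
        split x∈C with x∈p∪q⁻ A ⁅ z ⁆ (p⊆q∧∣q∣≤∣p∣⇒q⊆p A∪z⊆C ∣C∣≤∣A∪z∣ x∈C)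
        ... | inj₁ x∈A = inj₁ x∈A
        ... | inj₂ x∈z = inj₂ (x∈⁅y⁆⇒x≡y z x∈z)
        exit : ∀ {x} → x ∈ A → d + x ∉ A → d + x ≡ z
        exit x∈A dx∉A with split (d+A⊆C x∈A)
        ... | inj₁ dx∈A = contradiction dx∈A dx∉A
        ... | inj₂ dx≡z = dx≡z
        P = chain (⊂-wellFounded A) d≢0 ∣A∣<p z∉A exit

      -- If e + b ∉ A then e + (B ∖ 0) = C ∖ A, so two such e would make C ∖ A
      -- periodic, while a single one contradicts Cauchy–Davenport for A ∖ e.
      vosper-descent : 2 < ∣ B ∣ →
        ∃[ e ] e ∈ A × dysonʳ e A B ⊂ B × 1 < ∣ dysonʳ e A B ∣
      vosper-descent 2<∣B∣
        with Fin.any? (λ e → (e ∈? A) ×-dec (dysonʳ e A B ⊂? B) ×-dec (2 ≤? ∣ dysonʳ e A B ∣))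
      ... | yes found = found
      ... | no  none with 1<∣p∣⇒∃≢ B 0# 1<∣B∣
      ...   | d , d∈B , d≢0 with escape A≢∅ d≢0 ∣A∣<p
      ...     | e , e∈A , de∉A = contradiction 2<∣B∣ (<⇒≱ (s≤s ∣B∣≤2))
        where
        ed∉A : e + d ∉ A
        ed∉A = subst (_∉ A) (comm d e) de∉A
        -- The failed search means that every transform which shrinks `B` collapses it; since 0
        -- survives, to {0} exactly.
        ∣dysonʳ∣≤1 : ∀ {e b} → e ∈ A → b ∈ B → e + b ∉ A → ∣ dysonʳ e A B ∣ ≤ 1
        ∣dysonʳ∣≤1 {e} e∈A b∈B eb∉A = s≤s⁻¹ (≰⇒> λ big → none (e , e∈A , dysonʳ-⊂ b∈B eb∉A , big))
        returns⇒0 : ∀ {e b b′} → e ∈ A → b ∈ B → e + b ∉ A → b′ ∈ B → e + b′ ∈ A → b′ ≡ 0#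
        returns⇒0 e∈A b∈B eb∉A b′∈B eb′∈A =
          ∣p∣≤1⇒≡ (∣dysonʳ∣≤1 e∈A b∈B eb∉A) (0∈dysonʳ e∈A 0∈B) (∈-dysonʳ⁺ b′∈B eb′∈A)
        dysonˡ⊆C : dysonˡ e A B ⊆ C
        dysonˡ⊆C {x} x∈ with ∈-dysonˡ⁻ x∈
        ... | inj₁ x∈A  = ⊞⊆⇒⊆ 0∈B A+B⊆C x∈A
        ... | inj₂ xe∈B = subst (_∈ C) (⊖-cancel x e) (A+B⊆C e∈A xe∈B)
        -- The transform does not lower |A| + |B|, and its second set has at most one element, so
        -- criticality forces A ∪ (e + B) to fill `C`.
        ∣C∣≤∣dysonˡ∣ : ∣ C ∣ ≤ ∣ dysonˡ e A B ∣
        ∣C∣≤∣dysonˡ∣ = s≤s⁻¹ (begin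
          suc ∣ C ∣                              ≤⟨ critical ⟩
          ∣ A ∣ ℕ.+ ∣ B ∣                        ≤⟨ dyson-size e A B ⟩
          ∣ dysonˡ e A B ∣ ℕ.+ ∣ dysonʳ e A B ∣  ≤⟨ +-monoʳ-≤ ∣ dysonˡ e A B ∣ (∣dysonʳ∣≤1 e∈A d∈B ed∉A) ⟩
          ∣ dysonˡ e A B ∣ ℕ.+ 1                 ≡⟨ +-comm ∣ dysonˡ e A B ∣ 1 ⟩
          suc ∣ dysonˡ e A B ∣                   ∎)
          where open ≤-Reasoning
        D : Subset m
        D = C ─ A
        D⊖e⊆B : ∀ {x} → x ∈ D → x ⊖ e ∈ B
        D⊖e⊆B x∈D with ∈-dysonˡ⁻ (p⊆q∧∣q∣≤∣p∣⇒q⊆p dysonˡ⊆C ∣C∣≤∣dysonˡ∣ (p─q⊆p C A x∈D))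
        ... | inj₁ x∈A  = contradiction x∈A (x∈p─q⇒x∉q C A x∈D)
        ... | inj₂ xe∈B = xe∈B
        -- As x - e lies in `B`, the sum f + (x - e) lies in `C`. Were it in `A`, `returns⇒0` would
        -- give x = e, although `x` lies outside `A`.
        D-periodic : ∀ {f b} → f ∈ A → b ∈ B → f + b ∉ A → ∀ {x} → x ∈ D → (f ⊖ e) + x ∈ D
        D-periodic {f} f∈A b∈B fb∉A {x} x∈D = subst (_∈ D) (sym eq) (x∈p∧x∉q⇒x∈p─q
          (A+B⊆C f∈A (D⊖e⊆B x∈D))
          λ back → x∈p─q⇒x∉q C A x∈D (subst (_∈ A)
            (sym (x∙y⁻¹≈ε⇒x≈y x e (returns⇒0 f∈A b∈B fb∉A (D⊖e⊆B x∈D) back))) e∈A))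
          where
          eq : (f ⊖ e) + x ≡ f + (x ⊖ e)
          eq = trans (+-exchange f x e) (comm (x ⊖ e) f)
        rest : (A - e) ⊞ B ⊆ A
        rest {f} {b} f∈ b∈B = decidable-stable (f + b ∈? A) λ fb∉A → contradiction
          (periodic⇒p≤∣A∣
            (e + d , x∈p∧x∉q⇒x∈p─q (A+B⊆C e∈A d∈B) ed∉A)
            (λ fe≡0 → x∈p-y⇒x≢y A e f∈ (x∙y⁻¹≈ε⇒x≈y f e fe≡0))
            (D-periodic (x∈p-y⇒x∈p A e f∈) b∈B fb∉A))
          (<⇒≱ (≤-trans (s≤s (∣p─q∣≤∣p∣ C A)) ∣C∣<p))
        A-e≢∅ : Nonempty (A - e)
        A-e≢∅ with 1<∣p∣⇒∃≢ A e 1<∣A∣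
        ... | f , f∈A , f≢e = f , x∈p∧x≢y⇒x∈p-y f∈A f≢e
        ∣B∣≤2 : ∣ B ∣ ≤ 2
        -- Since B shifts `A - e` into `A`, Cauchy-Davenport reads (|A| - 1) + |B| ≤ |A| + 1.
        ∣B∣≤2 = +-cancelˡ-≤ ∣ A - e ∣ _ _ (begin
          ∣ A - e ∣ ℕ.+ ∣ B ∣  ≤⟨ cauchy-davenport A-e≢∅ 0∈B rest ∣A∣<p ⟩
          suc ∣ A ∣            ≤⟨ s≤s (∣p∣≤1+∣p-x∣ A e) ⟩
          2 ℕ.+ ∣ A - e ∣      ≡⟨ +-comm 2 ∣ A - e ∣ ⟩
          ∣ A - e ∣ ℕ.+ 2      ∎)
          where open ≤-Reasoning

    -- Descent preserves 0 ∈ B, |B| ≥ 2 and criticality for the same `C`. It must therefore stop at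
    -- a pair, and the progression found there is the original `C`.
    vosper-acc : ∀ {A B C} → Acc _⊂_ B → 0# ∈ B → A ⊞ B ⊆ C → ∣ C ∣ < p →
      1 < ∣ A ∣ → 1 < ∣ B ∣ → suc ∣ C ∣ ≤ ∣ A ∣ ℕ.+ ∣ B ∣ → Progression C
    vosper-acc {A} {B} (acc rec) 0∈B A+B⊆C ∣C∣<p 1<∣A∣ 1<∣B∣ critical with ∣ B ∣ ≤? 2
    ... | yes ∣B∣≤2 = vosper-pair 0∈B A+B⊆C ∣C∣<p 1<∣A∣ 1<∣B∣ critical ∣B∣≤2
    ... | no  ∣B∣≰2 with vosper-descent 0∈B A+B⊆C ∣C∣<p 1<∣A∣ 1<∣B∣ critical (≰⇒> ∣B∣≰2)
    ...   | e , e∈A , smaller , 1<∣B′∣ = vosper-acc (rec smaller)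
      (0∈dysonʳ e∈A 0∈B) (dyson-sums A+B⊆C) ∣C∣<p
      (≤-trans 1<∣A∣ (∣p∣≤∣p∪q∣ A _)) 1<∣B′∣ (≤-trans critical (dyson-size e A B))

    vosper : ∀ {A B C} → 0# ∈ B → A ⊞ B ⊆ C → ∣ C ∣ < p →
      1 < ∣ A ∣ → 1 < ∣ B ∣ → suc ∣ C ∣ ≤ ∣ A ∣ ℕ.+ ∣ B ∣ → Progression C
    vosper {B = B} = vosper-acc (⊂-wellFounded B)

-- Matching bases

module Matchings {c ℓ : Level} (G : FiniteAbelianGroup c ℓ) where

  open FiniteAbelianGroup G
  open Over G
  open Matroid
  private module A = AbelianGroup abelianGroup

  -- Transport of the group structure to indices

  index-cong : ∀ {x y} → x ≈ y → index x ≡ index y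
  index-cong = Inverse.to-cong enumeration

  index-element : ∀ i → index (element i) ≡ i
  index-element = Inverse.strictlyInverseˡ enumeration

  element-index : ∀ x → element (index x) ≈ x
  element-index = Inverse.strictlyInverseʳ enumeration

  index-injective : ∀ {x y} → index x ≡ index y → x ≈ y
  index-injective {x} {y} eq = A.trans (A.sym (element-index x))
    (A.trans (Inverse.from-cong enumeration eq) (element-index y))

  element-injective : ∀ {i j} → element i ≈ element j → i ≡ j
  element-injective {i} {j} eq = trans (sym (index-element i)) (trans (index-cong eq) (index-element j))

  infixl 6 _+ᶠ_
  _+ᶠ_ : Op₂ (Fin order)
  i +ᶠ j = index (element i + element j)

  0ᶠ : Fin order
  0ᶠ = index 0#

  -ᶠ_ : Op₁ (Fin order)
  -ᶠ i = index (- element i)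

  rawGroupᶠ : RawGroup 0ℓ 0ℓ
  rawGroupᶠ = record { _≈_ = _≡_ ; _∙_ = _+ᶠ_ ; ε = 0ᶠ ; _⁻¹ = -ᶠ_ }

  -- Injectivity of `element` pulls the group laws back to `Fin order`, where subsets live and
  -- equality is propositional.
  element-isGroupMonomorphism : IsGroupMonomorphism rawGroupᶠ A.rawGroup element
  element-isGroupMonomorphism = record
    { isGroupHomomorphism = record
      { isMonoidHomomorphism = record
        { isMagmaHomomorphism = record
          { isRelHomomorphism = record { cong = Inverse.from-cong enumeration }
          ; homo = λ i j → element-index (element i + element j)
          }
        ; ε-homo = element-index 0#
        }
      ; ⁻¹-homo = λ i → element-index (- element i)
      }
    ; injective = element-injective
    }

  isAbelianGroupᶠ : IsAbelianGroup _≡_ _+ᶠ_ 0ᶠ -ᶠ_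
  isAbelianGroupᶠ = GroupMonomorphism.isAbelianGroup element-isGroupMonomorphism A.isAbelianGroup

  module F = Sumsets _+ᶠ_ 0ᶠ -ᶠ_ isAbelianGroupᶠ

  index-+ : ∀ x y → index (x + y) ≡ index x +ᶠ index y
  index-+ x y = index-cong (A.sym (A.∙-cong (element-index x) (element-index y)))

  index-neg : ∀ x → index (- x) ≡ -ᶠ index x
  index-neg x = index-cong (A.sym (A.⁻¹-cong (element-index x)))

  index-· : ∀ k x → index (k · x) ≡ k F.· index x
  index-· zero    x = refl
  index-· (suc k) x = trans (index-+ x (k · x)) (cong (index x +ᶠ_) (index-· k x))

  fromIndexedProgression : ∀ {A} → F.Progression A → IsProgression A
  fromIndexedProgression (k , a , d , iff) = k , element a , element d , λ x → mk⇔
    (λ x∈A → let i , eq = Equivalence.to (iff (index x)) x∈A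
             in i , index-injective (trans eq (sym (index-term (toℕ i)))))
    (λ (i , eq) → Equivalence.from (iff (index x)) (i , trans (index-cong eq) (index-term (toℕ i))))
    where
    index-term : ∀ i → index (element a + i · element d) ≡ a +ᶠ i F.· d
    index-term i = trans (index-+ (element a) (i · element d)) (cong₂ _+ᶠ_ (index-element a)
      (trans (index-· i (element d)) (cong (i F.·_) (index-element d))))

  fromIndexedSubgroup : ∀ {H} → F.IsSubgroup H → IsSubgroup H
  fromIndexedSubgroup {H} sub = record
    { 0∈       = F.IsSubgroup.0∈ sub
    ; +-closed = λ {x} {y} x∈ y∈ → subst (_∈ H) (sym (index-+ x y)) (F.IsSubgroup.+-closed sub x∈ y∈)
    ; -‿closed = λ {x} x∈ → subst (_∈ H) (sym (index-neg x)) (F.IsSubgroup.-‿closed sub x∈)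
    }

  Is-p⇒minimal : ∀ {p} → Is-p p → ∀ {H d} → F.IsSubgroup H → d ∈ H → d ≢ 0ᶠ → p ≤ ∣ H ∣
  Is-p⇒minimal (_ , min) {H} {d} sub d∈H d≢0 = min H
    (fromIndexedSubgroup sub , element d , subst (_∈ H) (sym (index-element d)) d∈H
    , λ d≈0 → d≢0 (trans (sym (index-element d)) (index-cong d≈0)))

  -- Bases and matchings between them

  basis-size : ∀ (M : Matroid) {n B} → HasRank M n → IsBasis M B → ∣ B ∣ ≡ n
  basis-size M {n} {B} ((I , I-ind , ∣I∣≡n) , ≤n) (B-ind , B-max) with n ≤? ∣ B ∣
  ... | yes n≤∣B∣ = ≤-antisym (≤n B-ind) n≤∣B∣
  ... | no  n≰∣B∣ with augmentation M B-ind I-ind (subst (∣ B ∣ <_) (sym ∣I∣≡n) (≰⇒> n≰∣B∣))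
  ...   | e , _ , e∉B , B∪e-ind = contradiction (B-max B∪e-ind (p⊆p∪q ⁅ e ⁆) (q⊆p∪q B ⁅ e ⁆ (x∈⁅x⁆ e))) e∉B

  maximum⇒basis : ∀ (M : Matroid) {n I} → HasRank M n → Independent M I → ∣ I ∣ ≡ n → IsBasis M I
  maximum⇒basis M (_ , ≤n) I-ind refl = I-ind , λ J-ind I⊆J → p⊆q∧∣q∣≤∣p∣⇒q⊆p I⊆J (≤n J-ind)

  -- Listing `𝓝` along the matching, in the order induced by `𝓜`, lets the identity serve as the
  -- permutation. Equal cardinalities make this list exhaust `𝓝`.
  matching⇒BasisMatched : ∀ M {𝓜 𝓝 f} → InjectiveOn 𝓜 f →
    (∀ {i} → i ∈ 𝓜 → f i ∈ 𝓝 × i +ᶠ f i ∉ E M) → ∣ 𝓝 ∣ ≡ ∣ 𝓜 ∣ →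
    BasisMatched M ∣ 𝓜 ∣ 𝓜 𝓝
  matching⇒BasisMatched M {𝓜} {𝓝} {f} f-inj f∈ ∣𝓝∣≡∣𝓜∣ =
    element ∘ e , element ∘ f ∘ e
    , (enumerate-injective 𝓜 ∘ element-injective
      , λ x → mk⇔
        (λ x∈ → let i , eq = enumerate-surjective 𝓜 x∈ in i , index-injective (trans (sym eq) (sym (index-element _))))
        (λ (i , eq) → subst (_∈ 𝓜) (sym (trans (index-cong eq) (index-element _))) (enumerate-∈ 𝓜 i)))
    , (enumerate-injective 𝓜 ∘ f-inj (enumerate-∈ 𝓜 _) (enumerate-∈ 𝓜 _) ∘ element-injective
      , λ x → mk⇔ (onto x)
        (λ (i , eq) → subst (_∈ 𝓝) (sym (trans (index-cong eq) (index-element _))) (proj₁ (f∈ (enumerate-∈ 𝓜 i)))))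
    , Permutation.id , λ i → proj₂ (f∈ (enumerate-∈ 𝓜 i))
    where
    e : Fin ∣ 𝓜 ∣ → Fin order
    e = enumerate 𝓜
    onto : ∀ x → x ∈ᴳ 𝓝 → ∃[ i ] x ≈ element (f (e i))
    onto x x∈ with injection⇒surjection 𝓜 𝓝 f f-inj (proj₁ ∘ f∈) (≤-reflexive ∣𝓝∣≡∣𝓜∣) x∈
    ... | j , j∈𝓜 , fj≡x with enumerate-surjective 𝓜 j∈𝓜
    ...   | i , refl = i , index-injective (trans (sym fj≡x) (sym (index-element _)))

  ∈-⊕⁺ : ∀ {i j X} → i +ᶠ j ∈ X → j ∈ (- element i) ⊕ X
  ∈-⊕⁺ {i} {j} {X} ij∈X = ∈-setOf⁺
    -- The predicate repeats the one inside `_⊕_`, so that `setOf` of it is that set by computation.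
    (λ u → Fin.any? (λ v → (v ∈? X) ×-dec (u Fin.≟ index (- element i + element v))))
    (i +ᶠ j , ij∈X , trans (sym (index-element j)) (index-cong j≈))
    where
    j≈ : element j ≈ - element i + element (i +ᶠ j)
    j≈ = A.sym (A.trans (A.∙-congˡ (element-index _)) (A.trans (A.sym (A.assoc _ _ _))
      (A.trans (A.∙-congʳ (A.inverseˡ _)) (A.identityˡ _))))

  ∈-⊕⁻ : ∀ {i j X} → j ∈ (- element i) ⊕ X → i +ᶠ j ∈ X
  ∈-⊕⁻ {i} {j} {X} j∈ with ∈-setOf⁻
    (λ u → Fin.any? (λ v → (v ∈? X) ×-dec (u Fin.≟ index (- element i + element v)))) j∈
  ... | v , v∈X , refl = subst (_∈ X) (sym (trans (index-cong v≈) (index-element v))) v∈X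
    where
    v≈ : element i + element (index (- element i + element v)) ≈ element v
    v≈ = A.trans (A.∙-congˡ (element-index _)) (A.trans (A.sym (A.assoc _ _ _))
      (A.trans (A.∙-congʳ (A.inverseʳ _)) (A.identityˡ _)))

  partner? : ∀ X 𝓝 i j → Dec (j ∈ 𝓝 × i +ᶠ j ∉ X)
  partner? X 𝓝 i j = (j ∈? 𝓝) ×-dec ¬? (i +ᶠ j ∈? X)

  partners : SubsetOfG → SubsetOfG → Fin order → SubsetOfG
  partners X 𝓝 i = setOf (partner? X 𝓝 i)

  -- In the application X = E(M) and Y = E(N).
  module _ {p n : ℕ} {X 𝓜 𝓝 Y : SubsetOfG} (isp : Is-p p) (1+n<p : suc n < p)
    (∣X∣≡1+n : ∣ X ∣ ≡ suc n) (𝓜⊆X : 𝓜 ⊆ X) (𝓝⊆Y : 𝓝 ⊆ Y)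
    (∣𝓜∣≡n : ∣ 𝓜 ∣ ≡ n) (∣𝓝∣≡n : ∣ 𝓝 ∣ ≡ n)
    (generic : ∀ a → a ∈ᴳ X → ∣ ((- a) ⊕ X) ∩ Y ∣ ≢ n)
    (¬progression : ¬ IsProgression X) (0∉Y : 0# ∉ᴳ Y) where

    private
      compatible : Fin order → SubsetOfG
      compatible = partners X 𝓝

    module _ {S : SubsetOfG} (S⊆𝓜 : S ⊆ 𝓜) (violates : ∣ neighbours compatible S ∣ < ∣ S ∣) where

      U T : SubsetOfG
      U = 𝓝 ─ neighbours compatible S
      T = U ∪ ⁅ 0ᶠ ⁆

      U⊆Y : U ⊆ Y
      U⊆Y u∈U = 𝓝⊆Y (p─q⊆p 𝓝 _ u∈U)

      S⊞U⊆X : S F.⊞ U ⊆ X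
      S⊞U⊆X {s} {u} s∈S u∈U = decidable-stable (s +ᶠ u ∈? X) λ su∉X →
        x∈p─q⇒x∉q 𝓝 _ u∈U (∈-neighbours⁺ compatible s∈S
          (∈-setOf⁺ (partner? X 𝓝 s) (p─q⊆p 𝓝 _ u∈U , su∉X)))

      S⊞T⊆X : S F.⊞ T ⊆ X
      S⊞T⊆X {s} s∈S t∈T with x∈p∪q⁻ U ⁅ 0ᶠ ⁆ t∈T
      ... | inj₁ t∈U = S⊞U⊆X s∈S t∈U
      ... | inj₂ t∈0 with x∈⁅y⁆⇒x≡y 0ᶠ t∈0
      ...   | refl = subst (_∈ X) (sym (IsAbelianGroup.identityʳ isAbelianGroupᶠ s)) (𝓜⊆X (S⊆𝓜 s∈S))

      -- `U` and the neighbours of `S` cover `𝓝`. One extra unit comes from the strict violation of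
      -- Hall's condition, the other from the 0 in `T`.
      2+n≤∣S∣+1+∣U∣ : 2 ℕ.+ n ≤ ∣ S ∣ ℕ.+ suc ∣ U ∣
      2+n≤∣S∣+1+∣U∣ = begin
        2 ℕ.+ n                                        ≡⟨ cong (2 ℕ.+_) ∣𝓝∣≡n ⟨
        2 ℕ.+ ∣ 𝓝 ∣                                    ≤⟨ s≤s (s≤s (p⊆q⇒∣p∣≤∣q∣ cover)) ⟩
        2 ℕ.+ ∣ neighbours compatible S ∪ U ∣          ≤⟨ s≤s (s≤s (∣p∪q∣≤∣p∣+∣q∣ (neighbours compatible S) U)) ⟩
        2 ℕ.+ (∣ neighbours compatible S ∣ ℕ.+ ∣ U ∣)  ≡⟨ cong suc (+-suc ∣ neighbours compatible S ∣ ∣ U ∣) ⟨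
        suc ∣ neighbours compatible S ∣ ℕ.+ suc ∣ U ∣  ≤⟨ +-monoˡ-≤ (suc ∣ U ∣) violates ⟩
        ∣ S ∣ ℕ.+ suc ∣ U ∣                            ∎
        where
        open ≤-Reasoning
        cover : 𝓝 ⊆ neighbours compatible S ∪ U
        cover {y} y∈𝓝 with y ∈? neighbours compatible S
        ... | yes y∈N = x∈p∪q⁺ (inj₁ y∈N)
        ... | no  y∉N = x∈p∪q⁺ (inj₂ (x∈p∧x∉q⇒x∈p─q y∈𝓝 y∉N))

      ∣T∣≡1+∣U∣ : ∣ T ∣ ≡ suc ∣ U ∣
      ∣T∣≡1+∣U∣ = ∣p∪⁅x⁆∣≡1+∣p∣ U (0∉Y ∘ U⊆Y)

      -- As |S| ≤ |𝓜| = n, the count leaves at least two elements for `T`, as Vosper's theorem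
      -- demands.
      1<∣T∣ : 1 < ∣ T ∣
      1<∣T∣ = +-cancelˡ-≤ n _ _ (begin
        n ℕ.+ 2              ≡⟨ +-comm n 2 ⟩
        2 ℕ.+ n              ≤⟨ 2+n≤∣S∣+1+∣U∣ ⟩
        ∣ S ∣ ℕ.+ suc ∣ U ∣  ≤⟨ +-monoˡ-≤ (suc ∣ U ∣) (≤-trans (p⊆q⇒∣p∣≤∣q∣ S⊆𝓜) (≤-reflexive ∣𝓜∣≡n)) ⟩
        n ℕ.+ suc ∣ U ∣      ≡⟨ cong (n ℕ.+_) ∣T∣≡1+∣U∣ ⟨
        n ℕ.+ ∣ T ∣          ∎)
        where open ≤-Reasoning

      ∣S∣≤1 : ∣ S ∣ ≤ 1
      ∣S∣≤1 = ≮⇒≥ λ 1<∣S∣ → ¬progression (fromIndexedProgression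
        (F.vosper (Is-p⇒minimal isp) (q⊆p∪q U _ (x∈⁅x⁆ 0ᶠ)) S⊞T⊆X
          (subst (_< p) (sym ∣X∣≡1+n) 1+n<p) 1<∣S∣ 1<∣T∣
          (subst (λ k → suc k ≤ ∣ S ∣ ℕ.+ ∣ T ∣) (sym ∣X∣≡1+n)
            (subst (λ k → 2 ℕ.+ n ≤ ∣ S ∣ ℕ.+ k) (sym ∣T∣≡1+∣U∣) 2+n≤∣S∣+1+∣U∣))))

      -- The lower bound holds because `U` lies in the intersection and |S| ≤ 1 forces |U| ≥ n. For
      -- the upper bound, adding `s` injects the intersection into `X`, and it misses `s` because 0
      -- ∉ Y.
      singleton-exceptional : ∀ {s} → s ∈ S → ∣ ((- element s) ⊕ X) ∩ Y ∣ ≡ n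
      singleton-exceptional {s} s∈S = ≤-antisym
        (s≤s⁻¹ (≤-trans
          (s≤s (injection⇒∣p∣≤∣q∣ _ (X - s) (s +ᶠ_) (λ {x} {y} _ _ → ∙-cancelˡ s x y) lands))
          (≤-trans (x∈p⇒∣p-x∣<∣p∣ (𝓜⊆X (S⊆𝓜 s∈S))) (≤-reflexive ∣X∣≡1+n))))
        (≤-trans n≤∣U∣ (p⊆q⇒∣p∣≤∣q∣ λ u∈U → x∈p∩q⁺ (∈-⊕⁺ (S⊞U⊆X s∈S u∈U) , U⊆Y u∈U)))
        where
        open AbelianGroupProperties F.𝔾 using (∙-cancelˡ; identityʳ-unique)
        n≤∣U∣ : n ≤ ∣ U ∣
        n≤∣U∣ = s≤s⁻¹ (s≤s⁻¹ (≤-trans 2+n≤∣S∣+1+∣U∣ (+-monoˡ-≤ (suc ∣ U ∣) ∣S∣≤1)))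
        lands : ∀ {x} → x ∈ ((- element s) ⊕ X) ∩ Y → s +ᶠ x ∈ X - s
        lands {x} x∈ with x∈p∩q⁻ ((- element s) ⊕ X) Y x∈
        ... | x∈⊕ , x∈Y = x∈p∧x≢y⇒x∈p-y (∈-⊕⁻ x∈⊕) λ sx≡s →
          0∉Y (subst (_∈ Y) (identityʳ-unique s x sx≡s) x∈Y)

      no-violation : ⊥
      no-violation with 0<∣p∣⇒Nonempty (≤-trans (s≤s z≤n) violates)
      ... | s , s∈S = generic (element s)
        (subst (_∈ X) (sym (index-element s)) (𝓜⊆X (S⊆𝓜 s∈S))) (singleton-exceptional s∈S)

    partners-hall : HallCondition (partners X 𝓝) 𝓜
    partners-hall S⊆𝓜 = ≮⇒≥ (no-violation S⊆𝓜)

theorem2p12 : ∀ {c ℓ : Level} (G : FiniteAbelianGroup c ℓ) →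
    let open FiniteAbelianGroup G
        open Over G
        open Matroid
    in
    (M N : Matroid) (n p : ℕ) →
    Loopless M → Loopless N →
    HasRank M n → HasRank N n →
    ∣ E M ∣ ≡ suc n → ∣ E N ∣ ≡ suc n →
    Is-p p → suc n < p →
    (∀ a → a ∈ᴳ E M → ∣ ((- a) ⊕ E M) ∩ E N ∣ ≢ n) →
    ¬ IsProgression (E M) → ¬ IsSemiProgression (E M) →
    0# ∉ᴳ E N →
    Matched n M N
theorem2p12 G M N n p _ _ rankM rankN@((𝓝 , 𝓝-ind , ∣𝓝∣≡n) , _) ∣EM∣ _ isp 1+n<p generic ¬prog _ 0∉EN
  𝓜 𝓜-basis@(𝓜-ind , _) =
  -- The independent set witnessing the rank of `N` is a basis chosen before `𝓜`: the same `𝓝`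
  -- serves every basis of `M`.
  𝓝 , maximum⇒basis N rankN 𝓝-ind ∣𝓝∣≡n , subst (λ k → BasisMatched M k 𝓜 𝓝) ∣𝓜∣≡n
    (matching⇒BasisMatched M f-inj (λ i∈𝓜 → ∈-setOf⁻ (partner? (E M) 𝓝 _) (f∈ i∈𝓜)) (trans ∣𝓝∣≡n (sym ∣𝓜∣≡n)))
  where
  open Over G
  open Matroid
  open Matchings G
  ∣𝓜∣≡n = basis-size M rankM 𝓜-basis
  matching = hall 0ᶠ _ (partners-hall isp 1+n<p ∣EM∣ (ground M 𝓜-ind) (ground N 𝓝-ind) ∣𝓜∣≡n ∣𝓝∣≡n generic ¬prog 0∉EN)
  f-inj = proj₁ (proj₂ matching)
  f∈ = proj₂ (proj₂ matching)
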